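{- Let $G$ be a topological group acting on $\mathcal W$ by negligibility-preserving self-homeomorphisms, and let $0\in\mathcal W$ be a base point. If the action of $G$ on $\mathcal W$ is transitive and $T\subset\mathcal W$ is any tile, then $\omega_0(\Psi_0(T))=T$. Moreover, if (still with a transitive action) $\mathcal T$ is a finite set of tiles and $\mu$ is a Borel measure on $G$ such that $\omega_0$ is nonsingular and negligibility-preserving, then $\mathcal T$ and $\Psi_0(\mathcal T)=\{\Psi_0(T):T\in\mathcal T\}$ have the same cotilers, up to renaming each $T$ into $\Psi_0(T)$: a countable set $C\subset G\times\mathcal T$ satisfies $\mathcal W\equiv_\lambda\bigsqcup_{(g,T)\in C}g\cdot T$ if and only if it satisfies $G\equiv_\mu\bigsqcup_{(g,T)\in C}g\,\Psi_0(T)$.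
   Context: $\mathcal W$ is a topological space with a nontrivial Borel measure $\lambda$. The group $G$ acts on $\mathcal W$ by self-homeomorphisms that are negligibility-preserving: $\lambda(A)>0\implies\lambda(g\cdot A)>0$ for all $g\in G$. A tile is a positive-measure subset of $\mathcal W$. For a measure $\nu$, $\equiv_\nu$ is equality up to $\nu$-negligible sets, and $\bigsqcup$ is a union (indexed by $C$) that is disjoint up to negligible sets. A cotiler for a set $\mathcal T$ of tiles in $\mathcal W$ is a countable $C\subset G\times\mathcal T$ with $\mathcal W\equiv_\lambda\bigsqcup_{(g,T)\in C}g\cdot T$; cotilers in $G$ are defined likewise, $G$ acting on itself by left multiplication. The orbit map of the base point $0\in\mathcal W$ is $\omega_0:G\to\mathcal W$, $g\mapsto g\cdot 0$, and for $T\subset\mathcal W$, $\Psi_0(T)=\omega_0^{ -1}(T)=\{g\in G : g\cdot 0\in T\}$. The map $\omega_0$ is nonsingular if the preimage of any $\lambda$-negligible set is $\mu$-negligible, and negligibility-preserving if the image of any $\mu$-negligible set is $\lambda$-negligible. -}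

module Defs where

open import Algebra.Structures using (IsGroup)
open import Data.Fin.Base using (Fin)
open import Data.Maybe.Base using (Maybe; just)
open import Data.Nat.Base using (ℕ; zero; suc)
open import Data.Product.Base using (∃-syntax; Σ-syntax; _×_; _,_; uncurry)
open import Data.Rational.Base using (ℚ; 0ℚ; ½; _+_; _*_; _≤_; _<_)
open import Data.Rational.Properties as ℚ using ()
open import Function.Bundles using (_⇔_)
open import Function.Definitions using (Inverseᵇ)
open import Level using (Level; Lift; lift) renaming (suc to ℓ-suc)
open import Relation.Binary.PropositionalEquality
  using (_≡_; _≢_; sym; trans)
open import Relation.Unary
  using (Pred; _∈_; _⊆_; _≐_; _⊥_; _∩_; _∪_; _∖_; ∁; ⋃; Empty; _⊢_)
open import Relation.Unary.Polymorphic using (U)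

private
  variable
    ℓ : Level

-- A number x ∈ [0,∞] is represented by its rounded lower cut {q ∈ ℚ : q < x};
-- thus 0 is {q : q < 0} and ∞ is all of ℚ.

record [0,∞] (ℓ : Level) : Set (ℓ-suc ℓ) where
  field
    Below          : Pred ℚ ℓ
    below-negative : ∀ {q} → q < 0ℚ → Below q
    below-down     : ∀ {p q} → p ≤ q → Below q → Below p
    below-open     : ∀ {q} → Below q → ∃[ r ] q < r × Below r

open [0,∞] public

infix 4 _≈_
infixl 6 _⊕_

_≈_ : [0,∞] ℓ → [0,∞] ℓ → Set ℓ
x ≈ y = Below x ≐ Below y

IsPositive : [0,∞] ℓ → Set ℓ
IsPositive x = Below x 0ℚ

0∞ : [0,∞] ℓ
0∞ {ℓ} = record
  { Below          = λ q → Lift ℓ (q < 0ℚ)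
  ; below-negative = lift
  ; below-down     = λ { p≤q (lift q<0) → lift (ℚ.≤-<-trans p≤q q<0) }
  ; below-open     = λ { (lift q<0) → let r , q<r , r<0 = ℚ.<-dense q<0
                                     in r , q<r , lift r<0 }
  }

_⊕_ : [0,∞] ℓ → [0,∞] ℓ → [0,∞] ℓ
x ⊕ y = record
  { Below          = λ q → ∃[ a ] ∃[ b ] Below x a × Below y b × q ≤ a + b
  ; below-negative = λ {q} q<0 →
      let h = half-negative q<0
      in q * ½ , q * ½ , below-negative x h , below-negative y h
       , ℚ.≤-reflexive (sym (half+half q))
  ; below-down     = λ { p≤q (a , b , xa , yb , q≤) →
      a , b , xa , yb , ℚ.≤-trans p≤q q≤ }
  ; below-open     = λ { (a , b , xa , yb , q≤) →
      let a′ , a<a′ , xa′ = below-open x xa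
      in a′ + b , ℚ.≤-<-trans q≤ (ℚ.+-monoˡ-< b a<a′) , a′ , b , xa′ , yb , ℚ.≤-refl }
  }
  where
  half-negative : ∀ {q} → q < 0ℚ → q * ½ < 0ℚ
  half-negative q<0 = ℚ.*-monoˡ-<-pos ½ q<0

  half+half : ∀ q → q * ½ + q * ½ ≡ q
  half+half q = trans (sym (ℚ.*-distribˡ-+ q ½ ½)) (ℚ.*-identityʳ q)

partialSum : (ℕ → [0,∞] ℓ) → ℕ → [0,∞] ℓ
partialSum x zero    = 0∞
partialSum x (suc n) = partialSum x n ⊕ x n

-- The sum of a series in [0,∞], as the supremum of its partial sums.

series : (ℕ → [0,∞] ℓ) → [0,∞] ℓ
series x = record
  { Below          = λ q → ∃[ n ] Below (partialSum x n) q
  ; below-negative = λ q<0 → 0 , below-negative (partialSum x 0) q<0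
  ; below-down     = λ { p≤q (n , s) → n , below-down (partialSum x n) p≤q s }
  ; below-open     = λ { (n , s) → let r , q<r , s′ = below-open (partialSum x n) s
                                   in r , q<r , n , s′ }
  }

-- Sets are types with propositional equality; subsets of X : Set ℓ are
-- predicates in Pred X ℓ, compared by extensional equality _≐_.

record Topology (X : Set ℓ) : Set (ℓ-suc (ℓ-suc ℓ)) where
  field
    Open      : Pred (Pred X ℓ) (ℓ-suc ℓ)
    open-resp : ∀ {A B} → A ≐ B → Open A → Open B
    open-U    : Open U
    open-∩    : ∀ {A B} → Open A → Open B → Open (A ∩ B)
    open-⋃    : ∀ (I : Set ℓ) {A : I → Pred X ℓ} → (∀ i → Open (A i)) → Open (⋃ I A)

open Topology public

Continuous : {X Y : Set ℓ} → Topology X → Topology Y → (X → Y) → Set (ℓ-suc ℓ)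
Continuous 𝒮 𝒯 f = ∀ {V} → Open 𝒯 V → Open 𝒮 (f ⊢ V)

IsHomeomorphism : {X Y : Set ℓ} → Topology X → Topology Y → (X → Y) → Set (ℓ-suc ℓ)
IsHomeomorphism 𝒮 𝒯 f =
  ∃[ f⁻¹ ] Inverseᵇ _≡_ _≡_ f f⁻¹ × Continuous 𝒮 𝒯 f × Continuous 𝒯 𝒮 f⁻¹

_×ₜ_ : {X Y : Set ℓ} → Topology X → Topology Y → Topology (X × Y)
_×ₜ_ {ℓ = ℓ} {X = X} {Y = Y} 𝒮 𝒯 = record
  { Open      = λ W → ∀ x y → (x , y) ∈ W → Box W x y
  ; open-resp = λ { (A⊆B , B⊆A) oA x y xy∈B →
      let P , Q , oP , oQ , x∈P , y∈Q , sub = oA x y (B⊆A xy∈B)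
      in P , Q , oP , oQ , x∈P , y∈Q , λ p q → A⊆B (sub p q) }
  ; open-U    = λ x y _ → U , U , open-U 𝒮 , open-U 𝒯 , _ , _ , _
  ; open-∩    = λ { oA oB x y (a , b) →
      let P , Q , oP , oQ , x∈P , y∈Q , sub = oA x y a
          P′ , Q′ , oP′ , oQ′ , x∈P′ , y∈Q′ , sub′ = oB x y b
      in P ∩ P′ , Q ∩ Q′ , open-∩ 𝒮 oP oP′ , open-∩ 𝒯 oQ oQ′
       , (x∈P , x∈P′) , (y∈Q , y∈Q′)
       , λ { (p , p′) (q , q′) → sub p q , sub′ p′ q′ } }
  ; open-⋃    = λ { I oA x y (i , a) →
      let P , Q , oP , oQ , x∈P , y∈Q , sub = oA i x y a
      in P , Q , oP , oQ , x∈P , y∈Q , λ p q → i , sub p q }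
  }
  where
  Box : Pred (X × Y) ℓ → X → Y → Set (ℓ-suc ℓ)
  Box W x y = Σ[ P ∈ Pred X ℓ ] Σ[ Q ∈ Pred Y ℓ ]
    Open 𝒮 P × Open 𝒯 Q × x ∈ P × y ∈ Q ×
    (∀ {x′ y′} → x′ ∈ P → y′ ∈ Q → (x′ , y′) ∈ W)

data Borel {X : Set ℓ} (𝒯 : Topology X) : Pred (Pred X ℓ) (ℓ-suc ℓ) where
  borel-open : ∀ {A} → Open 𝒯 A → Borel 𝒯 A
  borel-∁    : ∀ {A} → Borel 𝒯 A → Borel 𝒯 (∁ A)
  borel-⋃    : ∀ {A : ℕ → Pred X ℓ} → (∀ n → Borel 𝒯 (A n)) → Borel 𝒯 (⋃ ℕ A)
  borel-resp : ∀ {A B} → A ≐ B → Borel 𝒯 A → Borel 𝒯 B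

-- By measure-cong, the value does not depend on the proof that a set is Borel.

record BorelMeasure {X : Set ℓ} (𝒯 : Topology X) : Set (ℓ-suc ℓ) where
  field
    measure       : ∀ {A} → Borel 𝒯 A → [0,∞] ℓ
    measure-cong  : ∀ {A B} (a : Borel 𝒯 A) (b : Borel 𝒯 B) →
                    A ≐ B → measure a ≈ measure b
    measure-empty : ∀ {A} (a : Borel 𝒯 A) → Empty A → measure a ≈ 0∞
    measure-⋃     : ∀ {A : ℕ → Pred X ℓ} (a : ∀ n → Borel 𝒯 (A n)) →
                    (∀ {m n} → m ≢ n → A m ⊥ A n) →
                    measure (borel-⋃ a) ≈ series (λ n → measure (a n))

open BorelMeasure public

module _ {X : Set ℓ} {𝒯 : Topology X} (ν : BorelMeasure 𝒯) where

  HasPositiveMeasure : Pred (Pred X ℓ) (ℓ-suc ℓ)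
  HasPositiveMeasure A = Σ[ a ∈ Borel 𝒯 A ] IsPositive (measure ν a)

  Nontrivial : Set (ℓ-suc ℓ)
  Nontrivial = HasPositiveMeasure U

  -- Negligible sets need not be Borel, only contained in a Borel null set.

  Negligible : Pred (Pred X ℓ) (ℓ-suc ℓ)
  Negligible N = ∃[ B ] N ⊆ B × Σ[ b ∈ Borel 𝒯 B ] (measure ν b ≈ 0∞)

  EqualUpToNegligible : Pred X ℓ → Pred X ℓ → Set (ℓ-suc ℓ)
  EqualUpToNegligible A B = Negligible ((A ∖ B) ∪ (B ∖ A))

image : {X Y : Set ℓ} → (X → Y) → Pred X ℓ → Pred Y ℓ
image f A y = ∃[ x ] x ∈ A × f x ≡ y

module _ {X Y : Set ℓ} {𝒮 : Topology X} {𝒯 : Topology Y}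
         (μ : BorelMeasure 𝒮) (ν : BorelMeasure 𝒯) where

  Nonsingular : (X → Y) → Set (ℓ-suc ℓ)
  Nonsingular f = ∀ {N} → Negligible ν N → Negligible μ (f ⊢ N)

  NegligibilityPreserving : (X → Y) → Set (ℓ-suc ℓ)
  NegligibilityPreserving f = ∀ {N} → Negligible μ N → Negligible ν (image f N)

record TopologicalGroup (ℓ : Level) : Set (ℓ-suc (ℓ-suc ℓ)) where
  infixl 7 _∙_
  infix  8 _⁻¹
  field
    Carrier  : Set ℓ
    _∙_      : Carrier → Carrier → Carrier
    ε        : Carrier
    _⁻¹      : Carrier → Carrier
    isGroup  : IsGroup _≡_ _∙_ ε _⁻¹
    topology : Topology Carrier
    ∙-continuous  : Continuous (topology ×ₜ topology) topology (uncurry _∙_)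
    ⁻¹-continuous : Continuous topology topology _⁻¹

  open IsGroup isGroup public using (assoc; identityˡ; identityʳ; inverseˡ; inverseʳ)

module _ (G : TopologicalGroup ℓ) where
  open TopologicalGroup G

  record Action (X : Set ℓ) : Set ℓ where
    infixr 7 _▷_
    field
      _▷_        : Carrier → X → X
      ▷-identity : ∀ x → ε ▷ x ≡ x
      ▷-assoc    : ∀ g h x → (g ∙ h) ▷ x ≡ g ▷ (h ▷ x)

  leftMultiplication : Action Carrier
  leftMultiplication = record
    { _▷_ = _∙_ ; ▷-identity = identityˡ ; ▷-assoc = assoc }

-- A subset C is countable if it is enumerated by ℕ, where indices may be skipped.

Countable : {A : Set ℓ} → Pred A ℓ → Set ℓ
Countable {A = A} C =
  Σ[ e ∈ (ℕ → Maybe A) ] (∀ x → x ∈ C ⇔ (∃[ n ] e n ≡ just x))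

module _ {G : TopologicalGroup ℓ} {X : Set ℓ} (act : Action G X) where
  open TopologicalGroup G using (Carrier)
  open Action act

  translate : Carrier → Pred X ℓ → Pred X ℓ
  translate g = image (g ▷_)

  Transitive : Set ℓ
  Transitive = ∀ x y → ∃[ g ] g ▷ x ≡ y

  ActsByHomeomorphisms : Topology X → Set (ℓ-suc ℓ)
  ActsByHomeomorphisms 𝒯 = ∀ g → IsHomeomorphism 𝒯 𝒯 (g ▷_)

  ActionNegligibilityPreserving : {𝒯 : Topology X} → BorelMeasure 𝒯 → Set (ℓ-suc ℓ)
  ActionNegligibilityPreserving ν =
    ∀ g {A} → HasPositiveMeasure ν A → HasPositiveMeasure ν (translate g A)

  orbitMap : X → Carrier → X
  orbitMap o g = g ▷ o

  Ψ : X → Pred X ℓ → Pred Carrier ℓ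
  Ψ o T = orbitMap o ⊢ T

  -- A finite set of subsets of X is given as a family T : Fin n → Pred X ℓ
  -- that is Distinct (below), so that a subset of G × {T i} is a subset C of
  -- Carrier × Fin n, and renaming each T i leaves C unchanged.

  module _ {𝒯 : Topology X} (ν : BorelMeasure 𝒯) {n : ℕ} (T : Fin n → Pred X ℓ)
           (C : Pred (Carrier × Fin n) ℓ) where

    translateBy : Carrier × Fin n → Pred X ℓ
    translateBy (g , i) = translate g (T i)

    unionOver : Pred X ℓ
    unionOver x = ∃[ p ] p ∈ C × x ∈ translateBy p

    DisjointUpToNegligible : Set (ℓ-suc ℓ)
    DisjointUpToNegligible = ∀ {p q} → p ∈ C → q ∈ C → p ≢ q →
      Negligible ν (translateBy p ∩ translateBy q)

    record IsCotiler : Set (ℓ-suc ℓ) where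
      field
        countable : Countable C
        covers    : EqualUpToNegligible ν U unionOver
        disjoint  : DisjointUpToNegligible

Distinct : {X : Set ℓ} {n : ℕ} → (Fin n → Pred X ℓ) → Set ℓ
Distinct T = ∀ i j → T i ≐ T j → i ≡ j

{-# OPTIONS --safe #-}

-- Translates commute with orbit preimages: g Ψ(T) = ω⁻¹(g T).  As ω is onto,
-- a subset N of W is the image of ω⁻¹(N), so the two hypotheses on ω say
-- exactly that N is negligible iff ω⁻¹(N) is.  Both cotiling conditions are
-- negligibility of sets built from translates, so they pass through ω⁻¹.

module Submission where

open import Defs
open import Level using (Level)
open import Data.Nat.Base using (ℕ)
open import Data.Fin.Base using (Fin)
open import Data.Product.Base using (_×_; _,_; ∃-syntax; map; map₂)
open import Data.Sum.Base as Sum using ()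
open import Function.Base using (_∘_; id)
open import Function.Bundles using (_⇔_; mk⇔; Equivalence)
open import Function.Construct.Composition using (_⇔-∘_)
open import Relation.Binary.PropositionalEquality
  using (_≡_; refl; sym; trans; cong; subst; module ≡-Reasoning)
open import Relation.Unary
  using (Pred; _⊆_; _≐_; _∩_; _∪_; _∖_; _⊢_)
open import Relation.Unary.Polymorphic using (U)

private
  variable
    ℓ : Level

module _ {X : Set ℓ} {𝒯 : Topology X} (ν : BorelMeasure 𝒯) where

  negligible-⊆ : ∀ {A B} → A ⊆ B → Negligible ν B → Negligible ν A
  negligible-⊆ A⊆B (N , B⊆N , null) = N , B⊆N ∘ A⊆B , null

  negligible-cong : ∀ {A B} → A ≐ B → Negligible ν A ⇔ Negligible ν B
  negligible-cong (A⊆B , B⊆A) = mk⇔ (negligible-⊆ B⊆A) (negligible-⊆ A⊆B)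

∩-cong : {X : Set ℓ} {A A′ B B′ : Pred X ℓ} → A ≐ A′ → B ≐ B′ → A ∩ B ≐ A′ ∩ B′
∩-cong (f , f′) (g , g′) = map f g , map f′ g′

symmetricDifference-congʳ : {X : Set ℓ} {A B B′ : Pred X ℓ} → B ≐ B′ →
  (A ∖ B) ∪ (B ∖ A) ≐ (A ∖ B′) ∪ (B′ ∖ A)
symmetricDifference-congʳ (f , f′) =
  -- `B` is negated in `A ∖ B`, so this half uses the inclusion of `B′` in `B`.
  Sum.map (map₂ (_∘ f′)) (map f id) ,
  Sum.map (map₂ (_∘ f)) (map f′ id)

module _ {X Y : Set ℓ} {f : X → Y} (surjective : ∀ y → ∃[ x ] f x ≡ y) where

  ⊆-image-preimage : ∀ {A : Pred Y ℓ} → A ⊆ image f (f ⊢ A)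
  ⊆-image-preimage {A} {y} y∈A =
    let x , fx≡y = surjective y in x , subst A (sym fx≡y) y∈A , fx≡y

  image-preimage : ∀ {A : Pred Y ℓ} → image f (f ⊢ A) ≐ A
  image-preimage {A} = (λ { (x , fx∈A , refl) → fx∈A }) , ⊆-image-preimage {A}

  preimage-reflects-⊆ : ∀ {A B : Pred Y ℓ} → (f ⊢ A) ⊆ (f ⊢ B) → A ⊆ B
  preimage-reflects-⊆ {A} {B} sub {y} y∈A =
    let x , fx≡y = surjective y in subst B fx≡y (sub (subst A (sym fx≡y) y∈A))

  -- By surjectivity a subset of `Y` is recovered from its preimage, so pulling back never merges
  -- two tiles. Hence `Fin n` still indexes the pulled-back tiles faithfully, and the same `C` can
  -- serve for both families.
  preimage-distinct : ∀ {n} {T : Fin n → Pred Y ℓ} →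
    Distinct T → Distinct (λ i → f ⊢ T i)
  preimage-distinct {T = T} distinct i j (sub , sup) =
    distinct i j ( preimage-reflects-⊆ {T i} {T j} sub
                 , preimage-reflects-⊆ {T j} {T i} sup)

  -- `N` is arbitrary, Borel or not, since `Negligible` asks only for a Borel null superset. The
  -- equivalence thus applies directly to sets built from translates.
  negligible-preimage :
    {𝒮 : Topology X} {𝒯 : Topology Y} (μ : BorelMeasure 𝒮) (ν : BorelMeasure 𝒯) →
    Nonsingular μ ν f → NegligibilityPreserving μ ν f →
    ∀ {N} → Negligible ν N ⇔ Negligible μ (f ⊢ N)
  negligible-preimage μ ν nonsingular preserving {N} =
    mk⇔ nonsingular (negligible-⊆ ν (⊆-image-preimage {N}) ∘ preserving)

module _ {G : TopologicalGroup ℓ} {X : Set ℓ} (act : Action G X) (o : X) where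
  open TopologicalGroup G
  open Action act

  ▷-cancelˡ : ∀ g x → g ⁻¹ ▷ g ▷ x ≡ x
  ▷-cancelˡ g x = begin
    g ⁻¹ ▷ g ▷ x   ≡⟨ ▷-assoc (g ⁻¹) g x ⟨
    (g ⁻¹ ∙ g) ▷ x ≡⟨ cong (_▷ x) (inverseˡ g) ⟩
    ε ▷ x          ≡⟨ ▷-identity x ⟩
    x              ∎
    where open ≡-Reasoning

  ∙-cancelˡ : ∀ g h → g ∙ (g ⁻¹ ∙ h) ≡ h
  ∙-cancelˡ g h = begin
    g ∙ (g ⁻¹ ∙ h) ≡⟨ assoc g (g ⁻¹) h ⟨
    (g ∙ g ⁻¹) ∙ h ≡⟨ cong (_∙ h) (inverseʳ g) ⟩
    ε ∙ h          ≡⟨ identityˡ h ⟩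
    h              ∎
    where open ≡-Reasoning

  -- As `g` acts invertibly, `h ▷ o` lies in the translate of `A` by `g` iff `g ⁻¹ ▷ h ▷ o` lies in
  -- `A`. That point is `(g ⁻¹ ∙ h) ▷ o`, and `g ⁻¹ ∙ h` is the only element that left
  -- multiplication by `g` sends to `h`.
  Ψ-translate : ∀ g A →
    Ψ act o (translate act g A) ≐ translate (leftMultiplication G) g (Ψ act o A)
  Ψ-translate g A = to , from
    where
    to : Ψ act o (translate act g A) ⊆ translate (leftMultiplication G) g (Ψ act o A)
    to {h} (x , x∈A , gx≡ho) = g ⁻¹ ∙ h , subst A (sym g⁻¹ho≡x) x∈A , ∙-cancelˡ g h
      where
      g⁻¹ho≡x : (g ⁻¹ ∙ h) ▷ o ≡ x
      g⁻¹ho≡x = trans (▷-assoc (g ⁻¹) h o)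
        (trans (cong (g ⁻¹ ▷_) (sym gx≡ho)) (▷-cancelˡ g x))

    from : translate (leftMultiplication G) g (Ψ act o A) ⊆ Ψ act o (translate act g A)
    from (h , ho∈A , refl) = h ▷ o , ho∈A , sym (▷-assoc g h o)

  module _ {𝒯 : Topology X} (ν : BorelMeasure 𝒯) (μ : BorelMeasure topology)
           {n : ℕ} (T : Fin n → Pred X ℓ) (C : Pred (Carrier × Fin n) ℓ) where

    -- Preimages commute with unions, so `Ψ-translate` applies member by member, with the same index
    -- in `C` on both sides.
    Ψ-unionOver : Ψ act o (unionOver act ν T C) ≐
                  unionOver (leftMultiplication G) μ (Ψ act o ∘ T) C
    Ψ-unionOver =
      (λ { ((g , i) , p∈C , m) →
        let to , _ = Ψ-translate g (T i) in (g , i) , p∈C , to m }) ,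
      (λ { ((g , i) , p∈C , m) →
        let _ , from = Ψ-translate g (T i) in (g , i) , p∈C , from m })

    cotiler-Ψ : (∀ {N} → Negligible ν N ⇔ Negligible μ (Ψ act o N)) →
      IsCotiler act ν T C ⇔ IsCotiler (leftMultiplication G) μ (Ψ act o ∘ T) C
    cotiler-Ψ negligible-Ψ = mk⇔
      (λ c → let open IsCotiler c in record
        -- Countability concerns `C` alone, which the renaming leaves unchanged.
        { countable = countable
        ; covers    = Equivalence.to covers-Ψ covers
        ; disjoint  = λ {p} {q} p∈C q∈C p≢q →
            Equivalence.to (overlap-Ψ p q) (disjoint p∈C q∈C p≢q) })
      (λ c → let open IsCotiler c in record
        { countable = countable
        ; covers    = Equivalence.from covers-Ψ covers
        ; disjoint  = λ {p} {q} p∈C q∈C p≢q →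
            Equivalence.from (overlap-Ψ p q) (disjoint p∈C q∈C p≢q) })
      where
      covers-Ψ : EqualUpToNegligible ν U (unionOver act ν T C) ⇔
        EqualUpToNegligible μ U (unionOver (leftMultiplication G) μ (Ψ act o ∘ T) C)
      covers-Ψ =
        -- `Ψ act o` computes through `U`, `∖` and `∪`, so after `negligible-Ψ` only the union
        -- remains to be rewritten.
        negligible-cong μ (symmetricDifference-congʳ {A = U} Ψ-unionOver) ⇔-∘ negligible-Ψ

      overlap-Ψ : ∀ p q →
        Negligible ν (translateBy act ν T C p ∩ translateBy act ν T C q) ⇔
        Negligible μ (translateBy (leftMultiplication G) μ (Ψ act o ∘ T) C p ∩
                      translateBy (leftMultiplication G) μ (Ψ act o ∘ T) C q)
      overlap-Ψ (g , i) (h , j) =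
        -- Likewise `Ψ act o` of an intersection is by definition the intersection of the preimages.
        negligible-cong μ (∩-cong (Ψ-translate g (T i)) (Ψ-translate h (T j)))
          ⇔-∘ negligible-Ψ

theorem23 : ∀ {ℓ : Level} (W : Set ℓ) (topW : Topology W) (vol : BorelMeasure topW) →
    Nontrivial vol →
    (G : TopologicalGroup ℓ) (act : Action G W) →
    ActsByHomeomorphisms act topW →
    ActionNegligibilityPreserving act vol →
    (o : W) →
    Transitive act →
    (∀ (T : Pred W ℓ) → HasPositiveMeasure vol T →
    image (orbitMap act o) (Ψ act o T) ≐ T)
    ×
    (∀ (n : ℕ) (T : Fin n → Pred W ℓ) →
    (∀ i → HasPositiveMeasure vol (T i)) →
    Distinct T →
    (μ : BorelMeasure (TopologicalGroup.topology G)) →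
    Nonsingular μ vol (orbitMap act o) →
    NegligibilityPreserving μ vol (orbitMap act o) →
    Distinct (Ψ act o ∘ T)
    ×
    (∀ (C : Pred (TopologicalGroup.Carrier G × Fin n) ℓ) →
    IsCotiler act vol T C
    ⇔ IsCotiler (leftMultiplication G) μ (Ψ act o ∘ T) C))
theorem23 W topW vol _ G act _ _ o transitive =
  -- Transitivity read from the base point, `transitive o`, is surjectivity of `orbitMap act o`.
  (λ T _ → image-preimage (transitive o)) ,
  λ n T _ distinct μ nonsingular preserving →
    preimage-distinct (transitive o) distinct ,
    λ C → cotiler-Ψ act o vol μ T C
      (negligible-preimage (transitive o) μ vol nonsingular preserving)
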